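{- The theory $\mathfrak{Q}'$ defined in the context below is recursively enumerable.
   Context: Work in a first-order language of arithmetic such as $\{0,S,+,\times,\leqslant\}$, with a fixed standard G\"odel numbering; $\ulcorner\alpha\urcorner$ denotes the numeral of the G\"odel number of $\alpha$. $\Sigma_1$-formulas are those built from bounded ($\Sigma_0$) formulas by existential quantification, closed under conjunction, disjunction, existential quantifiers and bounded universal quantifiers. ${\tt Q}$ denotes Robinson's Arithmetic: the finitely axiomatized theory consisting of the axioms of Peano Arithmetic without induction, plus $\forall x\exists y[x=0\vee x=S(y)]$. An r.e. theory $U$ is given by a $\Sigma_1$-formula defining (the G\"odel numbers of) its axioms; $\mathsf{Pr}_U(x)$ is the standard $\Sigma_1$ provability predicate built from it, expressing ``$x$ is the G\"odel number of a sentence provable in $U$''. A theory $U$ extends (contains) ${\tt Q}$ when $U$ proves every axiom of ${\tt Q}$. Define $\mathfrak{Q}' = {\tt Q} \cup \{\mathsf{Pr}_U(\ulcorner\varphi\rightarrow\psi\urcorner)\rightarrow[\mathsf{Pr}_U(\ulcorner\varphi\urcorner)\rightarrow\mathsf{Pr}_U(\ulcorner\psi\urcorner)] : U \text{ an r.e. theory}, \varphi,\psi \text{ sentences}\} \cup \{\sigma\rightarrow\mathsf{Pr}_U(\ulcorner\sigma\urcorner) : \sigma \text{ a } \Sigma_1\text{ -sentence}, U \supseteq {\tt Q} \text{ an r.e. theory}\}$. -}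

module Defs where

open import Data.Nat using (ℕ; zero; suc; _+_; _*_; _≤_; _<_)
open import Data.Empty using (⊥)
open import Data.Unit using (⊤)
open import Data.Product using (Σ; ∃; _×_; _,_)
open import Data.Sum using (_⊎_)
open import Data.Maybe using (Maybe; just)
open import Data.List using (List; []; _∷_)
open import Data.List.Membership.Propositional using (_∈_)
open import Relation.Binary.PropositionalEquality using (_≡_)
open import Function.Bundles using (_⇔_)

infixl 7 _`*_
infixl 6 _`+_
infix 4 _`=_ _`≤_
infixr 3 _`∧_
infixr 2 _`∨_
infixr 1 _`⇒_
infix 0 _`⇔_

data Term : Set where
  var  : ℕ → Term
  `0   : Term
  `S   : Term → Term
  _`+_ : Term → Term → Term
  _`*_ : Term → Term → Term

data Formula : Set where
  _`=_ : Term → Term → Formula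
  _`≤_ : Term → Term → Formula
  `⊥   : Formula
  _`⇒_ : Formula → Formula → Formula
  _`∧_ : Formula → Formula → Formula
  _`∨_ : Formula → Formula → Formula
  `∀   : Formula → Formula   -- binds variable 0
  `∃   : Formula → Formula   -- binds variable 0

`¬_ : Formula → Formula
`¬ φ = φ `⇒ `⊥

`⊤ : Formula
`⊤ = `⊥ `⇒ `⊥

_`⇔_ : Formula → Formula → Formula
φ `⇔ ψ = (φ `⇒ ψ) `∧ (ψ `⇒ φ)

num : ℕ → Term
num zero    = `0
num (suc n) = `S (num n)

renT : (ℕ → ℕ) → Term → Term
renT ρ (var n)   = var (ρ n)
renT ρ `0        = `0
renT ρ (`S t)    = `S (renT ρ t)
renT ρ (s `+ t)  = renT ρ s `+ renT ρ t
renT ρ (s `* t)  = renT ρ s `* renT ρ t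

shiftT : Term → Term
shiftT = renT suc

exts : (ℕ → Term) → ℕ → Term
exts σ zero    = var zero
exts σ (suc n) = shiftT (σ n)

substT : (ℕ → Term) → Term → Term
substT σ (var n)  = σ n
substT σ `0       = `0
substT σ (`S t)   = `S (substT σ t)
substT σ (s `+ t) = substT σ s `+ substT σ t
substT σ (s `* t) = substT σ s `* substT σ t

substF : (ℕ → Term) → Formula → Formula
substF σ (s `= t) = substT σ s `= substT σ t
substF σ (s `≤ t) = substT σ s `≤ substT σ t
substF σ `⊥       = `⊥
substF σ (φ `⇒ ψ) = substF σ φ `⇒ substF σ ψ
substF σ (φ `∧ ψ) = substF σ φ `∧ substF σ ψ
substF σ (φ `∨ ψ) = substF σ φ `∨ substF σ ψ
substF σ (`∀ φ)   = `∀ (substF (exts σ) φ)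
substF σ (`∃ φ)   = `∃ (substF (exts σ) φ)

shiftF : Formula → Formula
shiftF = substF (λ n → var (suc n))

-- single substitution of t for variable 0 (other variables go down by one)
_∷ₛ_ : Term → (ℕ → Term) → ℕ → Term
(t ∷ₛ σ) zero    = t
(t ∷ₛ σ) (suc n) = σ n

_[_]₀ : Formula → Term → Formula
φ [ t ]₀ = substF (t ∷ₛ var) φ

TermBelow : ℕ → Term → Set
TermBelow k (var n)  = n < k
TermBelow k `0       = ⊤
TermBelow k (`S t)   = TermBelow k t
TermBelow k (s `+ t) = TermBelow k s × TermBelow k t
TermBelow k (s `* t) = TermBelow k s × TermBelow k t

FreeBelow : ℕ → Formula → Set
FreeBelow k (s `= t) = TermBelow k s × TermBelow k t
FreeBelow k (s `≤ t) = TermBelow k s × TermBelow k t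
FreeBelow k `⊥       = ⊤
FreeBelow k (φ `⇒ ψ) = FreeBelow k φ × FreeBelow k ψ
FreeBelow k (φ `∧ ψ) = FreeBelow k φ × FreeBelow k ψ
FreeBelow k (φ `∨ ψ) = FreeBelow k φ × FreeBelow k ψ
FreeBelow k (`∀ φ)   = FreeBelow (suc k) φ
FreeBelow k (`∃ φ)   = FreeBelow (suc k) φ

Sentence : Formula → Set
Sentence = FreeBelow 0

-- Bounded (Σ₀) and Σ₁ formulas.
-- Bounded quantifiers: ∀x≤t φ  :=  ∀x (x ≤ t → φ),  ∃x≤t φ := ∃x (x ≤ t ∧ φ),
-- with x not occurring in t (t is written shifted under the binder).

data IsΣ₀ : Formula → Set where
  eq   : ∀ s t → IsΣ₀ (s `= t)
  le   : ∀ s t → IsΣ₀ (s `≤ t)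
  bot  : IsΣ₀ `⊥
  imp  : ∀ {φ ψ} → IsΣ₀ φ → IsΣ₀ ψ → IsΣ₀ (φ `⇒ ψ)
  conj : ∀ {φ ψ} → IsΣ₀ φ → IsΣ₀ ψ → IsΣ₀ (φ `∧ ψ)
  disj : ∀ {φ ψ} → IsΣ₀ φ → IsΣ₀ ψ → IsΣ₀ (φ `∨ ψ)
  ball : ∀ t {φ} → IsΣ₀ φ → IsΣ₀ (`∀ (var 0 `≤ shiftT t `⇒ φ))
  bex  : ∀ t {φ} → IsΣ₀ φ → IsΣ₀ (`∃ (var 0 `≤ shiftT t `∧ φ))

data IsΣ₁ : Formula → Set where
  base : ∀ {φ} → IsΣ₀ φ → IsΣ₁ φ
  conj : ∀ {φ ψ} → IsΣ₁ φ → IsΣ₁ ψ → IsΣ₁ (φ `∧ ψ)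
  disj : ∀ {φ ψ} → IsΣ₁ φ → IsΣ₁ ψ → IsΣ₁ (φ `∨ ψ)
  ex   : ∀ {φ} → IsΣ₁ φ → IsΣ₁ (`∃ φ)
  ball : ∀ t {φ} → IsΣ₁ φ → IsΣ₁ (`∀ (var 0 `≤ shiftT t `⇒ φ))

_∷ᵉ_ : ℕ → (ℕ → ℕ) → ℕ → ℕ
(a ∷ᵉ ρ) zero    = a
(a ∷ᵉ ρ) (suc n) = ρ n

⟦_⟧t : Term → (ℕ → ℕ) → ℕ
⟦ var n  ⟧t ρ = ρ n
⟦ `0     ⟧t ρ = 0
⟦ `S t   ⟧t ρ = suc (⟦ t ⟧t ρ)
⟦ s `+ t ⟧t ρ = ⟦ s ⟧t ρ + ⟦ t ⟧t ρ
⟦ s `* t ⟧t ρ = ⟦ s ⟧t ρ * ⟦ t ⟧t ρ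

⟦_⟧ : Formula → (ℕ → ℕ) → Set
⟦ s `= t ⟧ ρ = ⟦ s ⟧t ρ ≡ ⟦ t ⟧t ρ
⟦ s `≤ t ⟧ ρ = ⟦ s ⟧t ρ ≤ ⟦ t ⟧t ρ
⟦ `⊥     ⟧ ρ = ⊥
⟦ φ `⇒ ψ ⟧ ρ = ⟦ φ ⟧ ρ → ⟦ ψ ⟧ ρ
⟦ φ `∧ ψ ⟧ ρ = ⟦ φ ⟧ ρ × ⟦ ψ ⟧ ρ
⟦ φ `∨ ψ ⟧ ρ = ⟦ φ ⟧ ρ ⊎ ⟦ ψ ⟧ ρ
⟦ `∀ φ   ⟧ ρ = (a : ℕ) → ⟦ φ ⟧ (a ∷ᵉ ρ)
⟦ `∃ φ   ⟧ ρ = Σ ℕ λ a → ⟦ φ ⟧ (a ∷ᵉ ρ)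

-- truth in the standard model (for sentences the environment is irrelevant)
True : Formula → Set
True φ = ⟦ φ ⟧ (λ _ → 0)

-- Gödel numbering (Cantor pairing based)

tri : ℕ → ℕ
tri zero    = zero
tri (suc n) = suc n + tri n

pair : ℕ → ℕ → ℕ
pair a b = tri (a + b) + b

gnT : Term → ℕ
gnT (var n)  = pair 0 n
gnT `0       = pair 1 0
gnT (`S t)   = pair 2 (gnT t)
gnT (s `+ t) = pair 3 (pair (gnT s) (gnT t))
gnT (s `* t) = pair 4 (pair (gnT s) (gnT t))

gn : Formula → ℕ
gn (s `= t) = pair 0 (pair (gnT s) (gnT t))
gn (s `≤ t) = pair 1 (pair (gnT s) (gnT t))
gn `⊥       = pair 2 0
gn (φ `⇒ ψ) = pair 3 (pair (gn φ) (gn ψ))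
gn (φ `∧ ψ) = pair 4 (pair (gn φ) (gn ψ))
gn (φ `∨ ψ) = pair 5 (pair (gn φ) (gn ψ))
gn (`∀ φ)   = pair 6 (gn φ)
gn (`∃ φ)   = pair 7 (gn φ)

⌜_⌝ : Formula → Term
⌜ φ ⌝ = num (gn φ)

-- Hilbert-style classical first-order calculus with equality.
-- Free variables in derived formulas are read universally.

data _⊢_ (Ax : Formula → Set) : Formula → Set where
  ax     : ∀ {φ} → Ax φ → Ax ⊢ φ
  mp     : ∀ {φ ψ} → Ax ⊢ (φ `⇒ ψ) → Ax ⊢ φ → Ax ⊢ ψ
  K      : ∀ φ ψ → Ax ⊢ (φ `⇒ ψ `⇒ φ)
  S      : ∀ φ ψ χ → Ax ⊢ ((φ `⇒ ψ `⇒ χ) `⇒ (φ `⇒ ψ) `⇒ φ `⇒ χ)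
  ∧-e₁   : ∀ φ ψ → Ax ⊢ (φ `∧ ψ `⇒ φ)
  ∧-e₂   : ∀ φ ψ → Ax ⊢ (φ `∧ ψ `⇒ ψ)
  ∧-i    : ∀ φ ψ → Ax ⊢ (φ `⇒ ψ `⇒ φ `∧ ψ)
  ∨-i₁   : ∀ φ ψ → Ax ⊢ (φ `⇒ φ `∨ ψ)
  ∨-i₂   : ∀ φ ψ → Ax ⊢ (ψ `⇒ φ `∨ ψ)
  ∨-e    : ∀ φ ψ χ → Ax ⊢ ((φ `⇒ χ) `⇒ (ψ `⇒ χ) `⇒ φ `∨ ψ `⇒ χ)
  efq    : ∀ φ → Ax ⊢ (`⊥ `⇒ φ)
  dne    : ∀ φ → Ax ⊢ (`¬ `¬ φ `⇒ φ)
  ∀-e    : ∀ φ t → Ax ⊢ (`∀ φ `⇒ φ [ t ]₀)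
  ∃-i    : ∀ φ t → Ax ⊢ (φ [ t ]₀ `⇒ `∃ φ)
  ∀-i    : ∀ {ψ φ} → Ax ⊢ (shiftF ψ `⇒ φ) → Ax ⊢ (ψ `⇒ `∀ φ)
  ∃-e    : ∀ {ψ φ} → Ax ⊢ (φ `⇒ shiftF ψ) → Ax ⊢ (`∃ φ `⇒ ψ)
  refl=  : ∀ t → Ax ⊢ (t `= t)
  subst= : ∀ φ s t → Ax ⊢ (s `= t `⇒ φ [ s ]₀ `⇒ φ [ t ]₀)

-- Robinson's arithmetic Q (universal closures; ≤ defined by its axiom)

private
  x y z : Term
  x = var 0
  y = var 1
  z = var 2

-- In `∀ (`∀ φ), the inner bound variable is var 0 and the outer is var 1.
QAxioms : List Formula
QAxioms =
    `∀ (`¬ (`S x `= `0))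
  ∷ `∀ (`∀ (`S y `= `S x `⇒ y `= x))
  ∷ `∀ (x `+ `0 `= x)
  ∷ `∀ (`∀ (y `+ `S x `= `S (y `+ x)))
  ∷ `∀ (x `* `0 `= `0)
  ∷ `∀ (`∀ (y `* `S x `= y `* x `+ y))
  ∷ `∀ (`∀ (y `≤ x `⇔ `∃ (z `+ var 0 `= var 1)))
  ∷ `∀ (`∃ (var 1 `= `0 `∨ var 1 `= `S (var 0)))
  ∷ []

-- r.e. theories: given by a Σ₁ formula θ(x) (only variable 0 free)
-- defining the Gödel numbers of its axioms.

IsRETheory : Formula → Set
IsRETheory θ = IsΣ₁ θ × FreeBelow 1 θ

AxiomOf : Formula → Formula → Set
AxiomOf θ α = Sentence α × True (θ [ ⌜ α ⌝ ]₀)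

ExtendsQ : Formula → Set
ExtendsQ θ = ∀ α → α ∈ QAxioms → AxiomOf θ ⊢ α

-- The theory 𝔔′, relative to a construction Pr of provability formulas:
-- Pr θ is the provability predicate Pr_U(x) (free variable 0) of the theory
-- U axiomatised by θ.

module _ (Pr : Formula → Formula) where

  PrOf : Formula → Formula → Formula
  PrOf θ φ = Pr θ [ ⌜ φ ⌝ ]₀

  data 𝔔′ : Formula → Set where
    qax : ∀ {α} → α ∈ QAxioms → 𝔔′ α
    kax : ∀ θ → IsRETheory θ → ∀ φ ψ → Sentence φ → Sentence ψ →
          𝔔′ (PrOf θ (φ `⇒ ψ) `⇒ (PrOf θ φ `⇒ PrOf θ ψ))
    sax : ∀ σ → IsΣ₁ σ → Sentence σ → ∀ θ → IsRETheory θ → ExtendsQ θ →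
          𝔔′ (σ `⇒ PrOf θ σ)

-- Recursive enumerability of a set of natural numbers: it is the range of an
-- (Agda-definable, hence computable) enumeration ℕ → Maybe ℕ.

RE : (ℕ → Set) → Set
RE P = Σ (ℕ → Maybe ℕ) λ f → ∀ n → P n ⇔ ∃ λ k → f k ≡ just n

GödelSet : (Formula → Set) → ℕ → Set
GödelSet T n = Σ Formula λ α → gn α ≡ n × T α

-- Every member of 𝔔′ has a finite certificate: the position of a Q-axiom;
-- or the data (θ, φ, ψ) of a distributivity axiom; or the data (σ, θ) of a
-- Σ₁-completeness axiom together with derivations, in the theory U defined
-- by θ, of all axioms of Q.  Side conditions are either decidable (being a
-- sentence), or built into the code (being Σ₁: we code proofs of IsΣ₁), or
-- checkable given further certificates.  The last case is the heart of the
-- matter: the axioms of U are those α for which the Σ₁ sentence θ(⌜α⌝) is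
-- true, and a true Σ₁ sentence has a finite certificate (a witness for each
-- ∃, one certificate per instance of a bounded ∀) which is checked by
-- deciding its Σ₀ parts.  Hence U-derivations, and so members of 𝔔′, are the
-- successful outputs of a total decoding function on binary trees; trees are
-- enumerated by ℕ through the inverse of Cantor pairing.

module Submission where

open import Defs
open import Data.Nat using (ℕ; zero; suc; _+_; _*_; _∸_; _⊔_; _≤_; _<_; s≤s; _≟_; _<?_; _≤?_)
open import Data.Nat.Properties
  using ( ≤-refl; ≤-trans; <⇒≤; +-comm; +-identityʳ; +-suc; n∸n≡0; m≤n+m; m+n∸n≡m
        ; m≤m⊔n; m≤n⊔m; m<n⇒m<1+n; m<1+n⇒m≤n; m<1+n⇒m<n∨m≡n; anyUpTo?; allUpTo? )
open import Data.Product using (Σ; ∃; _×_; _,_; proj₁; proj₂)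
open import Data.Sum using (inj₁; inj₂)
open import Data.Unit using (tt)
open import Data.Empty using (⊥-elim)
open import Data.Maybe using (Maybe; just; nothing; _>>=_; zipWith)
import Data.Maybe as Maybe
open import Data.List using (List; []; _∷_)
open import Data.List.Membership.Propositional using (_∈_)
open import Data.List.Relation.Unary.Any using (here; there)
open import Data.List.Relation.Unary.All using (All; []; _∷_; tabulate)
  renaming (lookup to lookupAll)
open import Function using (_∘_)
open import Function.Bundles using (_⇔_; mk⇔; Equivalence)
open import Relation.Nullary using (Dec; yes; no)
open import Relation.Nullary.Decidable
  using (dec⇒maybe; map′; _×-dec_; _⊎-dec_; _→-dec_)
  renaming (map to mapDec)
open import Relation.Binary.Definitions using (DecidableEquality)
open import Relation.Binary.PropositionalEquality
  using (_≡_; refl; sym; trans; cong; cong₂; subst; module ≡-Reasoning)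

open ≡-Reasoning

-- Trees and their enumeration

-- One step of the walk along the anti-diagonals of ℕ × ℕ: (a+1, b) moves to
-- (a, b+1), and the end (0, b) of a diagonal jumps to the start (b+1, 0) of
-- the next one.
nextPoint : ℕ × ℕ → ℕ × ℕ
nextPoint (zero  , b) = suc b , 0
nextPoint (suc a , b) = a , suc b

-- The n-th point of the walk; it inverts the Cantor pairing `pair` of Defs.
unpair : ℕ → ℕ × ℕ
unpair zero    = 0 , 0
unpair (suc n) = nextPoint (unpair n)

nextPoint-along : ∀ n b c → suc b ≤ n → nextPoint (n ∸ b , c) ≡ (n ∸ suc b , suc c)
nextPoint-along (suc n) zero    c _           = refl
nextPoint-along (suc n) (suc b) c (s≤s b<n) = nextPoint-along n b c b<n

mutual
  unpair-tri : ∀ n → unpair (tri n) ≡ (n , 0)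
  unpair-tri zero    = refl
  unpair-tri (suc n) = begin
    nextPoint (unpair (n + tri n))  ≡⟨ cong (nextPoint ∘ unpair) (+-comm n (tri n)) ⟩
    nextPoint (unpair (tri n + n))  ≡⟨ cong nextPoint (unpair-diagonal n n ≤-refl) ⟩
    nextPoint (n ∸ n , n)           ≡⟨ cong (λ m → nextPoint (m , n)) (n∸n≡0 n) ⟩
    (suc n , 0)                     ∎

  unpair-diagonal : ∀ n b → b ≤ n → unpair (tri n + b) ≡ (n ∸ b , b)
  unpair-diagonal n zero    _   = trans (cong unpair (+-identityʳ (tri n))) (unpair-tri n)
  unpair-diagonal n (suc b) b<n = begin
    unpair (tri n + suc b)          ≡⟨ cong unpair (+-suc (tri n) b) ⟩
    nextPoint (unpair (tri n + b))  ≡⟨ cong nextPoint (unpair-diagonal n b (<⇒≤ b<n)) ⟩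
    nextPoint (n ∸ b , b)           ≡⟨ nextPoint-along n b b b<n ⟩
    (n ∸ suc b , suc b)             ∎

unpair-pair : ∀ a b → unpair (pair a b) ≡ (a , b)
unpair-pair a b =
  trans (unpair-diagonal (a + b) b (m≤n+m b a)) (cong (_, b) (m+n∸n≡m a b))

-- Binary trees of naturals: a universal datatype of finite codes.
data Tree : Set where
  leaf : ℕ → Tree
  node : Tree → Tree → Tree

treeWithin : ℕ → ℕ → Tree
treeWithin zero    _ = leaf 0
treeWithin (suc d) c with unpair c
... | zero  , n = leaf n
... | suc _ , r = node (treeWithin d (proj₁ (unpair r))) (treeWithin d (proj₂ (unpair r)))

-- The enumeration of all trees: n codes a depth bound and a tree code.
tree : ℕ → Tree
tree n = treeWithin (proj₁ (unpair n)) (proj₂ (unpair n))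

codeOf : Tree → ℕ
codeOf (leaf n)   = pair 0 n
codeOf (node l r) = pair 1 (pair (codeOf l) (codeOf r))

depth : Tree → ℕ
depth (leaf _)   = 0
depth (node l r) = suc (depth l ⊔ depth r)

treeWithin-codeOf : ∀ t d → depth t < d → treeWithin d (codeOf t) ≡ t
treeWithin-codeOf (leaf n) (suc d) _ rewrite unpair-pair 0 n = refl
treeWithin-codeOf (node l r) (suc d) (s≤s l⊔r<d)
  rewrite unpair-pair 1 (pair (codeOf l) (codeOf r)) | unpair-pair (codeOf l) (codeOf r) =
  cong₂ node (treeWithin-codeOf l d (≤-trans (s≤s (m≤m⊔n _ _)) l⊔r<d))
             (treeWithin-codeOf r d (≤-trans (s≤s (m≤n⊔m _ _)) l⊔r<d))

tree-onto : ∀ t → ∃ λ n → tree n ≡ t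
tree-onto t = pair (suc (depth t)) (codeOf t) ,
  trans (cong (λ p → treeWithin (proj₁ p) (proj₂ p)) (unpair-pair (suc (depth t)) (codeOf t)))
        (treeWithin-codeOf t (suc (depth t)) ≤-refl)

-- Decoders

Succeeds : {A : Set} → Maybe A → Set
Succeeds {A} m = Σ A λ a → m ≡ just a

data _↓_ {A : Set} {P : A → Set} : Maybe (Σ A P) → A → Set where
  returns : ∀ {a} (pa : P a) → just (a , pa) ↓ a

↓⇒just : {A : Set} {P : A → Set} {m : Maybe (Σ A P)} {a : A} → m ↓ a → ∃ λ pa → m ≡ just (a , pa)
↓⇒just (returns pa) = pa , refl

mapCertificate : {A : Set} {P Q : A → Set} → (∀ {a} → P a → Q a) → Maybe (Σ A P) → Maybe (Σ A Q)
mapCertificate f = Maybe.map (λ (a , pa) → a , f pa)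

record Decoder {A : Set} (P : A → Set) : Set where
  field
    decode   : Tree → Maybe (Σ A P)
    complete : ∀ {a} → P a → ∃ λ t → decode t ↓ a
open Decoder

-- Decodable sets are r.e.: run the decoder on the n-th tree.
decodable⇒RE : {A : Set} {P : A → Set} (code : A → ℕ) → Decoder P →
               RE (λ n → Σ A λ a → code a ≡ n × P a)
decodable⇒RE {A} {P} code D = enumerate , λ n → mk⇔ (listed n) (sound n)
  where
  enumerate : ℕ → Maybe ℕ
  enumerate k = Maybe.map (code ∘ proj₁) (decode D (tree k))

  sound : ∀ n → (∃ λ k → enumerate k ≡ just n) → Σ A λ a → code a ≡ n × P a
  sound n (k , e) with decode D (tree k) | e
  ... | just (a , pa) | refl = a , refl , pa

  listed : ∀ n → (Σ A λ a → code a ≡ n × P a) → ∃ λ k → enumerate k ≡ just n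
  listed n (a , refl , pa) with complete D pa
  ... | t , hit with tree-onto t
  ... | k , tree-k≡t =
    k , cong (Maybe.map (code ∘ proj₁)) (trans (cong (decode D) tree-k≡t) (proj₂ (↓⇒just hit)))

dec⇒maybe-succeeds : {A : Set} (d : Dec A) → A → Succeeds (dec⇒maybe d)
dec⇒maybe-succeeds (yes a) _ = a , refl
dec⇒maybe-succeeds (no ¬a) a = ⊥-elim (¬a a)

map-succeeds : {A B : Set} {m : Maybe A} (f : A → B) → Succeeds m → Succeeds (Maybe.map f m)
map-succeeds f (a , refl) = f a , refl

zipWith-succeeds : {A B C : Set} {m : Maybe A} {n : Maybe B} (f : A → B → C) →
                   Succeeds m → Succeeds n → Succeeds (zipWith f m n)
zipWith-succeeds f (a , refl) (b , refl) = f a b , refl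

mapCertificate-↓ : {A : Set} {P Q : A → Set} {m : Maybe (Σ A P)} {a : A} (f : ∀ {a} → P a → Q a) →
                   m ↓ a → mapCertificate f m ↓ a
mapCertificate-↓ f (returns pa) = returns (f pa)

>>=-succeeds : {A B : Set} {m : Maybe A} {f : A → Maybe B} →
               (s : Succeeds m) → Succeeds (f (proj₁ s)) → Succeeds (m >>= f)
>>=-succeeds (x , refl) next = next

nth : {A : Set} (L : List A) → ℕ → Maybe (Σ A (_∈ L))
nth []      _       = nothing
nth (a ∷ L) zero    = just (a , here refl)
nth (a ∷ L) (suc i) = mapCertificate there (nth L i)

nth-position : {A : Set} {a : A} (L : List A) → a ∈ L → ∃ λ i → nth L i ↓ a
nth-position (a ∷ L) (here refl) = 0 , returns (here refl)
nth-position (b ∷ L) (there a∈L) with nth-position L a∈L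
... | i , hit = suc i , mapCertificate-↓ there hit

module _ {A : Set} {P : A → Set} (D : Decoder P) (_≟ᴬ_ : DecidableEquality A) where

  decodeAll : (L : List A) → Tree → Maybe (All P L)
  decodeAll []      _           = just []
  decodeAll (a ∷ L) (node t ts) =
    decode D t >>= λ (b , pb) →
    dec⇒maybe (b ≟ᴬ a) >>= λ b≡a →
    Maybe.map (subst P b≡a pb ∷_) (decodeAll L ts)
  decodeAll (a ∷ L) (leaf _)    = nothing

  decodeAll-complete : ∀ {L} → All P L → ∃ λ ts → Succeeds (decodeAll L ts)
  decodeAll-complete []                = leaf 0 , _ , refl
  decodeAll-complete (_∷_ {a} pa pas) with complete D pa | decodeAll-complete pas
  ... | t , hit | ts , rest = node t ts ,
    >>=-succeeds (_ , proj₂ (↓⇒just hit))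
      (>>=-succeeds (dec⇒maybe-succeeds (a ≟ᴬ a) refl) (map-succeeds _ rest))

-- Codes for syntax

encodeTerm : Term → Tree
encodeTerm (var n)  = node (leaf 0) (leaf n)
encodeTerm `0       = node (leaf 1) (leaf 0)
encodeTerm (`S t)   = node (leaf 2) (encodeTerm t)
encodeTerm (s `+ t) = node (leaf 3) (node (encodeTerm s) (encodeTerm t))
encodeTerm (s `* t) = node (leaf 4) (node (encodeTerm s) (encodeTerm t))

-- Total decoding; ill-formed codes are read as 0.
decodeTerm : Tree → Term
decodeTerm (node (leaf 0) (leaf n))   = var n
decodeTerm (node (leaf 2) a)          = `S (decodeTerm a)
decodeTerm (node (leaf 3) (node a b)) = decodeTerm a `+ decodeTerm b
decodeTerm (node (leaf 4) (node a b)) = decodeTerm a `* decodeTerm b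
decodeTerm _                          = `0

decodeᵗ-encode : ∀ t → decodeTerm (encodeTerm t) ≡ t
decodeᵗ-encode (var n)  = refl
decodeᵗ-encode `0       = refl
decodeᵗ-encode (`S t)   = cong `S (decodeᵗ-encode t)
decodeᵗ-encode (s `+ t) = cong₂ _`+_ (decodeᵗ-encode s) (decodeᵗ-encode t)
decodeᵗ-encode (s `* t) = cong₂ _`*_ (decodeᵗ-encode s) (decodeᵗ-encode t)

encodeFormula : Formula → Tree
encodeFormula (s `= t) = node (leaf 0) (node (encodeTerm s) (encodeTerm t))
encodeFormula (s `≤ t) = node (leaf 1) (node (encodeTerm s) (encodeTerm t))
encodeFormula `⊥       = node (leaf 2) (leaf 0)
encodeFormula (φ `⇒ ψ) = node (leaf 3) (node (encodeFormula φ) (encodeFormula ψ))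
encodeFormula (φ `∧ ψ) = node (leaf 4) (node (encodeFormula φ) (encodeFormula ψ))
encodeFormula (φ `∨ ψ) = node (leaf 5) (node (encodeFormula φ) (encodeFormula ψ))
encodeFormula (`∀ φ)   = node (leaf 6) (encodeFormula φ)
encodeFormula (`∃ φ)   = node (leaf 7) (encodeFormula φ)

-- Total decoding; ill-formed codes are read as ⊥.
decodeFormula : Tree → Formula
decodeFormula (node (leaf 0) (node a b)) = decodeTerm a `= decodeTerm b
decodeFormula (node (leaf 1) (node a b)) = decodeTerm a `≤ decodeTerm b
decodeFormula (node (leaf 3) (node a b)) = decodeFormula a `⇒ decodeFormula b
decodeFormula (node (leaf 4) (node a b)) = decodeFormula a `∧ decodeFormula b
decodeFormula (node (leaf 5) (node a b)) = decodeFormula a `∨ decodeFormula b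
decodeFormula (node (leaf 6) a)          = `∀ (decodeFormula a)
decodeFormula (node (leaf 7) a)          = `∃ (decodeFormula a)
decodeFormula _                          = `⊥

decodeᶠ-encode : ∀ φ → decodeFormula (encodeFormula φ) ≡ φ
decodeᶠ-encode (s `= t) = cong₂ _`=_ (decodeᵗ-encode s) (decodeᵗ-encode t)
decodeᶠ-encode (s `≤ t) = cong₂ _`≤_ (decodeᵗ-encode s) (decodeᵗ-encode t)
decodeᶠ-encode `⊥       = refl
decodeᶠ-encode (φ `⇒ ψ) = cong₂ _`⇒_ (decodeᶠ-encode φ) (decodeᶠ-encode ψ)
decodeᶠ-encode (φ `∧ ψ) = cong₂ _`∧_ (decodeᶠ-encode φ) (decodeᶠ-encode ψ)
decodeᶠ-encode (φ `∨ ψ) = cong₂ _`∨_ (decodeᶠ-encode φ) (decodeᶠ-encode ψ)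
decodeᶠ-encode (`∀ φ)   = cong `∀ (decodeᶠ-encode φ)
decodeᶠ-encode (`∃ φ)   = cong `∃ (decodeᶠ-encode φ)

_≟ᵗ_ : DecidableEquality Tree
leaf m   ≟ᵗ leaf n   = map′ (cong leaf) (λ { refl → refl }) (m ≟ n)
node a b ≟ᵗ node c d =
  map′ (λ (a≡c , b≡d) → cong₂ node a≡c b≡d) (λ { refl → refl , refl }) (a ≟ᵗ c ×-dec b ≟ᵗ d)
leaf _   ≟ᵗ node _ _ = no λ ()
node _ _ ≟ᵗ leaf _   = no λ ()

_≟ᶠ_ : DecidableEquality Formula
φ ≟ᶠ ψ = map′ same-code (cong encodeFormula) (encodeFormula φ ≟ᵗ encodeFormula ψ)
  where
  same-code : encodeFormula φ ≡ encodeFormula ψ → φ ≡ ψ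
  same-code e = begin
    φ                              ≡⟨ sym (decodeᶠ-encode φ) ⟩
    decodeFormula (encodeFormula φ) ≡⟨ cong decodeFormula e ⟩
    decodeFormula (encodeFormula ψ) ≡⟨ decodeᶠ-encode ψ ⟩
    ψ                              ∎

termBelow? : ∀ k t → Dec (TermBelow k t)
termBelow? k (var n)  = n <? k
termBelow? k `0       = yes tt
termBelow? k (`S t)   = termBelow? k t
termBelow? k (s `+ t) = termBelow? k s ×-dec termBelow? k t
termBelow? k (s `* t) = termBelow? k s ×-dec termBelow? k t

freeBelow? : ∀ k φ → Dec (FreeBelow k φ)
freeBelow? k (s `= t) = termBelow? k s ×-dec termBelow? k t
freeBelow? k (s `≤ t) = termBelow? k s ×-dec termBelow? k t
freeBelow? k `⊥       = yes tt
freeBelow? k (φ `⇒ ψ) = freeBelow? k φ ×-dec freeBelow? k ψ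
freeBelow? k (φ `∧ ψ) = freeBelow? k φ ×-dec freeBelow? k ψ
freeBelow? k (φ `∨ ψ) = freeBelow? k φ ×-dec freeBelow? k ψ
freeBelow? k (`∀ φ)   = freeBelow? (suc k) φ
freeBelow? k (`∃ φ)   = freeBelow? (suc k) φ

-- Σ₀ and Σ₁ formulas are coded together with the proof of their form.
decodeΣ₀ : Tree → Σ Formula IsΣ₀
decodeΣ₀ (node (leaf 0) (node s t)) = _ , eq (decodeTerm s) (decodeTerm t)
decodeΣ₀ (node (leaf 1) (node s t)) = _ , le (decodeTerm s) (decodeTerm t)
decodeΣ₀ (node (leaf 3) (node a b)) = _ , imp (proj₂ (decodeΣ₀ a)) (proj₂ (decodeΣ₀ b))
decodeΣ₀ (node (leaf 4) (node a b)) = _ , conj (proj₂ (decodeΣ₀ a)) (proj₂ (decodeΣ₀ b))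
decodeΣ₀ (node (leaf 5) (node a b)) = _ , disj (proj₂ (decodeΣ₀ a)) (proj₂ (decodeΣ₀ b))
decodeΣ₀ (node (leaf 6) (node t a)) = _ , ball (decodeTerm t) (proj₂ (decodeΣ₀ a))
decodeΣ₀ (node (leaf 7) (node t a)) = _ , bex (decodeTerm t) (proj₂ (decodeΣ₀ a))
decodeΣ₀ _                          = _ , bot

encodeΣ₀ : ∀ {φ} → IsΣ₀ φ → Tree
encodeΣ₀ (eq s t)   = node (leaf 0) (node (encodeTerm s) (encodeTerm t))
encodeΣ₀ (le s t)   = node (leaf 1) (node (encodeTerm s) (encodeTerm t))
encodeΣ₀ bot        = node (leaf 2) (leaf 0)
encodeΣ₀ (imp p q)  = node (leaf 3) (node (encodeΣ₀ p) (encodeΣ₀ q))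
encodeΣ₀ (conj p q) = node (leaf 4) (node (encodeΣ₀ p) (encodeΣ₀ q))
encodeΣ₀ (disj p q) = node (leaf 5) (node (encodeΣ₀ p) (encodeΣ₀ q))
encodeΣ₀ (ball t p) = node (leaf 6) (node (encodeTerm t) (encodeΣ₀ p))
encodeΣ₀ (bex t p)  = node (leaf 7) (node (encodeTerm t) (encodeΣ₀ p))

decodeΣ₀-encode : ∀ {φ} (p : IsΣ₀ φ) → proj₁ (decodeΣ₀ (encodeΣ₀ p)) ≡ φ
decodeΣ₀-encode (eq s t)   = cong₂ _`=_ (decodeᵗ-encode s) (decodeᵗ-encode t)
decodeΣ₀-encode (le s t)   = cong₂ _`≤_ (decodeᵗ-encode s) (decodeᵗ-encode t)
decodeΣ₀-encode bot        = refl
decodeΣ₀-encode (imp p q)  = cong₂ _`⇒_ (decodeΣ₀-encode p) (decodeΣ₀-encode q)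
decodeΣ₀-encode (conj p q) = cong₂ _`∧_ (decodeΣ₀-encode p) (decodeΣ₀-encode q)
decodeΣ₀-encode (disj p q) = cong₂ _`∨_ (decodeΣ₀-encode p) (decodeΣ₀-encode q)
decodeΣ₀-encode (ball t p) =
  cong₂ (λ u φ → `∀ (var 0 `≤ shiftT u `⇒ φ)) (decodeᵗ-encode t) (decodeΣ₀-encode p)
decodeΣ₀-encode (bex t p)  =
  cong₂ (λ u φ → `∃ (var 0 `≤ shiftT u `∧ φ)) (decodeᵗ-encode t) (decodeΣ₀-encode p)

decodeΣ₁ : Tree → Σ Formula IsΣ₁
decodeΣ₁ (node (leaf 0) a)          = _ , base (proj₂ (decodeΣ₀ a))
decodeΣ₁ (node (leaf 1) (node a b)) = _ , conj (proj₂ (decodeΣ₁ a)) (proj₂ (decodeΣ₁ b))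
decodeΣ₁ (node (leaf 2) (node a b)) = _ , disj (proj₂ (decodeΣ₁ a)) (proj₂ (decodeΣ₁ b))
decodeΣ₁ (node (leaf 3) a)          = _ , ex (proj₂ (decodeΣ₁ a))
decodeΣ₁ (node (leaf 4) (node t a)) = _ , ball (decodeTerm t) (proj₂ (decodeΣ₁ a))
decodeΣ₁ _                          = _ , base bot

encodeΣ₁ : ∀ {φ} → IsΣ₁ φ → Tree
encodeΣ₁ (base p)   = node (leaf 0) (encodeΣ₀ p)
encodeΣ₁ (conj p q) = node (leaf 1) (node (encodeΣ₁ p) (encodeΣ₁ q))
encodeΣ₁ (disj p q) = node (leaf 2) (node (encodeΣ₁ p) (encodeΣ₁ q))
encodeΣ₁ (ex p)     = node (leaf 3) (encodeΣ₁ p)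
encodeΣ₁ (ball t p) = node (leaf 4) (node (encodeTerm t) (encodeΣ₁ p))

decodeΣ₁-encode : ∀ {φ} (p : IsΣ₁ φ) → proj₁ (decodeΣ₁ (encodeΣ₁ p)) ≡ φ
decodeΣ₁-encode (base p)   = decodeΣ₀-encode p
decodeΣ₁-encode (conj p q) = cong₂ _`∧_ (decodeΣ₁-encode p) (decodeΣ₁-encode q)
decodeΣ₁-encode (disj p q) = cong₂ _`∨_ (decodeΣ₁-encode p) (decodeΣ₁-encode q)
decodeΣ₁-encode (ex p)     = cong `∃ (decodeΣ₁-encode p)
decodeΣ₁-encode (ball t p) =
  cong₂ (λ u φ → `∀ (var 0 `≤ shiftT u `⇒ φ)) (decodeᵗ-encode t) (decodeΣ₁-encode p)

-- Substitution commutes with weakening, so it preserves the shape of bounds.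
substT-shiftT : ∀ σ t → substT (exts σ) (shiftT t) ≡ shiftT (substT σ t)
substT-shiftT σ (var n)  = refl
substT-shiftT σ `0       = refl
substT-shiftT σ (`S t)   = cong `S (substT-shiftT σ t)
substT-shiftT σ (s `+ t) = cong₂ _`+_ (substT-shiftT σ s) (substT-shiftT σ t)
substT-shiftT σ (s `* t) = cong₂ _`*_ (substT-shiftT σ s) (substT-shiftT σ t)

Σ₀-subst : ∀ σ {φ} → IsΣ₀ φ → IsΣ₀ (substF σ φ)
Σ₀-subst σ (eq s t)   = eq _ _
Σ₀-subst σ (le s t)   = le _ _
Σ₀-subst σ bot        = bot
Σ₀-subst σ (imp p q)  = imp (Σ₀-subst σ p) (Σ₀-subst σ q)
Σ₀-subst σ (conj p q) = conj (Σ₀-subst σ p) (Σ₀-subst σ q)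
Σ₀-subst σ (disj p q) = disj (Σ₀-subst σ p) (Σ₀-subst σ q)
Σ₀-subst σ (ball t {φ} p) =
  subst (λ u → IsΣ₀ (`∀ (var 0 `≤ u `⇒ substF (exts σ) φ))) (sym (substT-shiftT σ t))
        (ball (substT σ t) (Σ₀-subst (exts σ) p))
Σ₀-subst σ (bex t {φ} p) =
  subst (λ u → IsΣ₀ (`∃ (var 0 `≤ u `∧ substF (exts σ) φ))) (sym (substT-shiftT σ t))
        (bex (substT σ t) (Σ₀-subst (exts σ) p))

Σ₁-subst : ∀ σ {φ} → IsΣ₁ φ → IsΣ₁ (substF σ φ)
Σ₁-subst σ (base p)   = base (Σ₀-subst σ p)
Σ₁-subst σ (conj p q) = conj (Σ₁-subst σ p) (Σ₁-subst σ q)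
Σ₁-subst σ (disj p q) = disj (Σ₁-subst σ p) (Σ₁-subst σ q)
Σ₁-subst σ (ex p)     = ex (Σ₁-subst (exts σ) p)
Σ₁-subst σ (ball t {φ} p) =
  subst (λ u → IsΣ₁ (`∀ (var 0 `≤ u `⇒ substF (exts σ) φ))) (sym (substT-shiftT σ t))
        (ball (substT σ t) (Σ₁-subst (exts σ) p))

-- Σ₀ decision and Σ₁ certificates

⟦shiftT⟧ : ∀ t a ρ → ⟦ shiftT t ⟧t (a ∷ᵉ ρ) ≡ ⟦ t ⟧t ρ
⟦shiftT⟧ (var n)  a ρ = refl
⟦shiftT⟧ `0       a ρ = refl
⟦shiftT⟧ (`S t)   a ρ = cong suc (⟦shiftT⟧ t a ρ)
⟦shiftT⟧ (s `+ t) a ρ = cong₂ _+_ (⟦shiftT⟧ s a ρ) (⟦shiftT⟧ t a ρ)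
⟦shiftT⟧ (s `* t) a ρ = cong₂ _*_ (⟦shiftT⟧ s a ρ) (⟦shiftT⟧ t a ρ)

bounded-∀-semantics : ∀ t φ ρ →
  (∀ {a} → a < suc (⟦ t ⟧t ρ) → ⟦ φ ⟧ (a ∷ᵉ ρ)) ⇔ ⟦ `∀ (var 0 `≤ shiftT t `⇒ φ) ⟧ ρ
bounded-∀-semantics t φ ρ = mk⇔
  (λ h a a≤t → h (s≤s (subst (a ≤_) (⟦shiftT⟧ t a ρ) a≤t)))
  (λ h {a} a<1+t → h a (subst (a ≤_) (sym (⟦shiftT⟧ t a ρ)) (m<1+n⇒m≤n a<1+t)))

bounded-∃-semantics : ∀ t φ ρ →
  (∃ λ a → a < suc (⟦ t ⟧t ρ) × ⟦ φ ⟧ (a ∷ᵉ ρ)) ⇔ ⟦ `∃ (var 0 `≤ shiftT t `∧ φ) ⟧ ρ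
bounded-∃-semantics t φ ρ = mk⇔
  (λ (a , a<1+t , x) → a , subst (a ≤_) (sym (⟦shiftT⟧ t a ρ)) (m<1+n⇒m≤n a<1+t) , x)
  (λ (a , a≤t , x) → a , s≤s (subst (a ≤_) (⟦shiftT⟧ t a ρ) a≤t) , x)

Σ₀-decidable : ∀ {φ} → IsΣ₀ φ → ∀ ρ → Dec (⟦ φ ⟧ ρ)
Σ₀-decidable (eq s t)   ρ = ⟦ s ⟧t ρ ≟ ⟦ t ⟧t ρ
Σ₀-decidable (le s t)   ρ = ⟦ s ⟧t ρ ≤? ⟦ t ⟧t ρ
Σ₀-decidable bot        ρ = no λ ()
Σ₀-decidable (imp p q)  ρ = Σ₀-decidable p ρ →-dec Σ₀-decidable q ρ
Σ₀-decidable (conj p q) ρ = Σ₀-decidable p ρ ×-dec Σ₀-decidable q ρ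
Σ₀-decidable (disj p q) ρ = Σ₀-decidable p ρ ⊎-dec Σ₀-decidable q ρ
Σ₀-decidable (ball t {φ} p) ρ =
  mapDec (bounded-∀-semantics t φ ρ) (allUpTo? (λ a → Σ₀-decidable p (a ∷ᵉ ρ)) (suc (⟦ t ⟧t ρ)))
Σ₀-decidable (bex t {φ} p) ρ =
  mapDec (bounded-∃-semantics t φ ρ) (anyUpTo? (λ a → Σ₀-decidable p (a ∷ᵉ ρ)) (suc (⟦ t ⟧t ρ)))

-- Checking P a for all a < n, given a checker for each instance; the
-- certificate lists one certificate per instance, from n - 1 down to 0.
module _ {P : ℕ → Set} (check : (a : ℕ) → Tree → Maybe (P a)) where

  extendBelow : ∀ {n} → P n → (∀ {a} → a < n → P a) → ∀ {a} → a < suc n → P a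
  extendBelow pn below a<1+n with m<1+n⇒m<n∨m≡n a<1+n
  ... | inj₁ a<n  = below a<n
  ... | inj₂ refl = pn

  checkBelow : ∀ n → Tree → Maybe (∀ {a} → a < n → P a)
  checkBelow zero    _           = just λ ()
  checkBelow (suc n) (node c cs) = zipWith extendBelow (check n c) (checkBelow n cs)
  checkBelow (suc n) (leaf _)    = nothing

  checkBelow-complete : ∀ n → (∀ {a} → a < n → ∃ λ c → Succeeds (check a c)) →
                        ∃ λ cs → Succeeds (checkBelow n cs)
  checkBelow-complete zero    _       = leaf 0 , _ , refl
  checkBelow-complete (suc n) certify with certify ≤-refl | checkBelow-complete n (certify ∘ m<n⇒m<1+n)
  ... | c , ok | cs , oks = node c cs , zipWith-succeeds extendBelow ok oks

-- Checking a certificate for the truth of a Σ₁ formula: a witness for each ∃,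
-- a chosen side for each ∨, and one certificate per instance of a bounded ∀.
certified : ∀ {φ} → IsΣ₁ φ → ∀ ρ → Tree → Maybe (⟦ φ ⟧ ρ)
certified (base q)   ρ _                       = dec⇒maybe (Σ₀-decidable q ρ)
certified (conj p q) ρ (node c d)              = zipWith _,_ (certified p ρ c) (certified q ρ d)
certified (disj p q) ρ (node (leaf zero) c)    = Maybe.map inj₁ (certified p ρ c)
certified (disj p q) ρ (node (leaf (suc _)) c) = Maybe.map inj₂ (certified q ρ c)
certified (ex p)     ρ (node (leaf a) c)       = Maybe.map (a ,_) (certified p (a ∷ᵉ ρ) c)
certified (ball t {φ} p) ρ cs =
  Maybe.map (Equivalence.to (bounded-∀-semantics t φ ρ))
            (checkBelow (λ a → certified p (a ∷ᵉ ρ)) (suc (⟦ t ⟧t ρ)) cs)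
certified _          _ _                       = nothing

certificate : ∀ {φ} (p : IsΣ₁ φ) ρ → ⟦ φ ⟧ ρ → ∃ λ c → Succeeds (certified p ρ c)
certificate (base q) ρ x = leaf 0 , dec⇒maybe-succeeds (Σ₀-decidable q ρ) x
certificate (conj p q) ρ (x , y) with certificate p ρ x | certificate q ρ y
... | c , ok₁ | d , ok₂ = node c d , zipWith-succeeds _,_ ok₁ ok₂
certificate (disj p q) ρ (inj₁ x) with certificate p ρ x
... | c , ok = node (leaf 0) c , map-succeeds inj₁ ok
certificate (disj p q) ρ (inj₂ y) with certificate q ρ y
... | c , ok = node (leaf 1) c , map-succeeds inj₂ ok
certificate (ex p) ρ (a , x) with certificate p (a ∷ᵉ ρ) x
... | c , ok = node (leaf a) c , map-succeeds (a ,_) ok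
certificate (ball t {φ} p) ρ h
  with checkBelow-complete (λ a → certified p (a ∷ᵉ ρ)) (suc (⟦ t ⟧t ρ))
         (λ {a} a<1+t → certificate p (a ∷ᵉ ρ) (Equivalence.from (bounded-∀-semantics t φ ρ) h a<1+t))
... | cs , ok = cs , map-succeeds _ ok

-- Checking derivations in the theory U defined by a Σ₁ formula θ

module Derivations {θ : Formula} (θ-Σ₁ : IsΣ₁ θ) where

  Derivation : Set
  Derivation = Σ Formula (AxiomOf θ ⊢_)

  axiomOfU : Formula → Tree → Maybe Derivation
  axiomOfU α c =
    dec⇒maybe (freeBelow? 0 α) >>= λ α-sentence →
    Maybe.map (λ truth → α , ax (α-sentence , truth))
              (certified (Σ₁-subst (⌜ α ⌝ ∷ₛ var) θ-Σ₁) (λ _ → 0) c)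

  modusPonens : Maybe Derivation → Maybe Derivation → Maybe Derivation
  modusPonens (just ((φ `⇒ ψ) , d₁)) (just (φ′ , d₂)) with φ′ ≟ᶠ φ
  ... | yes refl = just (ψ , mp d₁ d₂)
  ... | no _     = nothing
  modusPonens _ _ = nothing

  generalise : Maybe Derivation → Formula → Maybe Derivation
  generalise (just ((φ `⇒ χ) , d)) ψ with φ ≟ᶠ shiftF ψ
  ... | yes refl = just (_ , ∀-i d)
  ... | no _     = nothing
  generalise _ _ = nothing

  eliminate∃ : Maybe Derivation → Formula → Maybe Derivation
  eliminate∃ (just ((χ `⇒ φ) , d)) ψ with φ ≟ᶠ shiftF ψ
  ... | yes refl = just (_ , ∃-e d)
  ... | no _     = nothing
  eliminate∃ _ _ = nothing

  decodeDerivation : Tree → Maybe Derivation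
  decodeDerivation (node (leaf 0) (node a c))          = axiomOfU (decodeFormula a) c
  decodeDerivation (node (leaf 1) (node d e))          = modusPonens (decodeDerivation d) (decodeDerivation e)
  decodeDerivation (node (leaf 2) (node a b))          = just (_ , K (decodeFormula a) (decodeFormula b))
  decodeDerivation (node (leaf 3) (node a (node b c))) =
    just (_ , S (decodeFormula a) (decodeFormula b) (decodeFormula c))
  decodeDerivation (node (leaf 4) (node a b))          = just (_ , ∧-e₁ (decodeFormula a) (decodeFormula b))
  decodeDerivation (node (leaf 5) (node a b))          = just (_ , ∧-e₂ (decodeFormula a) (decodeFormula b))
  decodeDerivation (node (leaf 6) (node a b))          = just (_ , ∧-i (decodeFormula a) (decodeFormula b))
  decodeDerivation (node (leaf 7) (node a b))          = just (_ , ∨-i₁ (decodeFormula a) (decodeFormula b))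
  decodeDerivation (node (leaf 8) (node a b))          = just (_ , ∨-i₂ (decodeFormula a) (decodeFormula b))
  decodeDerivation (node (leaf 9) (node a (node b c))) =
    just (_ , ∨-e (decodeFormula a) (decodeFormula b) (decodeFormula c))
  decodeDerivation (node (leaf 10) a)                  = just (_ , efq (decodeFormula a))
  decodeDerivation (node (leaf 11) a)                  = just (_ , dne (decodeFormula a))
  decodeDerivation (node (leaf 12) (node a t))         = just (_ , ∀-e (decodeFormula a) (decodeTerm t))
  decodeDerivation (node (leaf 13) (node a t))         = just (_ , ∃-i (decodeFormula a) (decodeTerm t))
  decodeDerivation (node (leaf 14) (node d b))         = generalise (decodeDerivation d) (decodeFormula b)
  decodeDerivation (node (leaf 15) (node d b))         = eliminate∃ (decodeDerivation d) (decodeFormula b)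
  decodeDerivation (node (leaf 16) t)                  = just (_ , refl= (decodeTerm t))
  decodeDerivation (node (leaf 17) (node a (node s t))) =
    just (_ , subst= (decodeFormula a) (decodeTerm s) (decodeTerm t))
  decodeDerivation _                                   = nothing

  axiomOfU-↓ : ∀ {α c} → Sentence α →
               Succeeds (certified (Σ₁-subst (⌜ α ⌝ ∷ₛ var) θ-Σ₁) (λ _ → 0) c) →
               axiomOfU α c ↓ α
  axiomOfU-↓ {α} α-sentence (_ , certified-truth) with freeBelow? 0 α
  ... | yes _            rewrite certified-truth = returns _
  ... | no not-sentence = ⊥-elim (not-sentence α-sentence)

  modusPonens-↓ : ∀ {m n φ ψ} → m ↓ (φ `⇒ ψ) → n ↓ φ → modusPonens m n ↓ ψ
  modusPonens-↓ {φ = φ} (returns _) (returns _) with φ ≟ᶠ φ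
  ... | yes refl = returns _
  ... | no φ≢φ   = ⊥-elim (φ≢φ refl)

  generalise-↓ : ∀ {m ψ φ} → m ↓ (shiftF ψ `⇒ φ) → generalise m ψ ↓ (ψ `⇒ `∀ φ)
  generalise-↓ {ψ = ψ} (returns _) with shiftF ψ ≟ᶠ shiftF ψ
  ... | yes refl = returns _
  ... | no ≢     = ⊥-elim (≢ refl)

  eliminate∃-↓ : ∀ {m ψ φ} → m ↓ (φ `⇒ shiftF ψ) → eliminate∃ m ψ ↓ (`∃ φ `⇒ ψ)
  eliminate∃-↓ {ψ = ψ} (returns _) with shiftF ψ ≟ᶠ shiftF ψ
  ... | yes refl = returns _
  ... | no ≢     = ⊥-elim (≢ refl)

  scheme-↓ : {X : Set} (F : X → Formula) (instance′ : ∀ x → AxiomOf θ ⊢ F x) {x′ x : X} →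
             x′ ≡ x → _↓_ {P = AxiomOf θ ⊢_} (just (F x′ , instance′ x′)) (F x)
  scheme-↓ F instance′ refl = returns (instance′ _)

  codes₂ : ∀ φ ψ → (decodeFormula (encodeFormula φ) , decodeFormula (encodeFormula ψ)) ≡ (φ , ψ)
  codes₂ φ ψ = cong₂ _,_ (decodeᶠ-encode φ) (decodeᶠ-encode ψ)

  codes₃ : ∀ φ ψ χ → (decodeFormula (encodeFormula φ) , decodeFormula (encodeFormula ψ) ,
                      decodeFormula (encodeFormula χ)) ≡ (φ , ψ , χ)
  codes₃ φ ψ χ = cong₂ _,_ (decodeᶠ-encode φ) (codes₂ ψ χ)

  -- Every derivation has a code: by induction on the derivation, with the
  -- certificate of truth of θ(⌜α⌝) at each axiom α of U.
  derivation-code : ∀ {φ} → AxiomOf θ ⊢ φ → ∃ λ t → decodeDerivation t ↓ φ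
  derivation-code (ax {α} (α-sentence , truth))
    with certificate (Σ₁-subst (⌜ α ⌝ ∷ₛ var) θ-Σ₁) (λ _ → 0) truth
  ... | c , ok = node (leaf 0) (node (encodeFormula α) c) ,
    subst (λ β → axiomOfU β c ↓ α) (sym (decodeᶠ-encode α)) (axiomOfU-↓ α-sentence ok)
  derivation-code (mp d e) with derivation-code d | derivation-code e
  ... | t , hit₁ | u , hit₂ = node (leaf 1) (node t u) , modusPonens-↓ hit₁ hit₂
  derivation-code (K φ ψ) = node (leaf 2) (node (encodeFormula φ) (encodeFormula ψ)) ,
    scheme-↓ (λ (a , b) → a `⇒ b `⇒ a) (λ (a , b) → K a b) (codes₂ φ ψ)
  derivation-code (S φ ψ χ) =
    node (leaf 3) (node (encodeFormula φ) (node (encodeFormula ψ) (encodeFormula χ))) ,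
    scheme-↓ (λ (a , b , c) → (a `⇒ b `⇒ c) `⇒ (a `⇒ b) `⇒ a `⇒ c) (λ (a , b , c) → S a b c)
             (codes₃ φ ψ χ)
  derivation-code (∧-e₁ φ ψ) = node (leaf 4) (node (encodeFormula φ) (encodeFormula ψ)) ,
    scheme-↓ (λ (a , b) → a `∧ b `⇒ a) (λ (a , b) → ∧-e₁ a b) (codes₂ φ ψ)
  derivation-code (∧-e₂ φ ψ) = node (leaf 5) (node (encodeFormula φ) (encodeFormula ψ)) ,
    scheme-↓ (λ (a , b) → a `∧ b `⇒ b) (λ (a , b) → ∧-e₂ a b) (codes₂ φ ψ)
  derivation-code (∧-i φ ψ) = node (leaf 6) (node (encodeFormula φ) (encodeFormula ψ)) ,
    scheme-↓ (λ (a , b) → a `⇒ b `⇒ a `∧ b) (λ (a , b) → ∧-i a b) (codes₂ φ ψ)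
  derivation-code (∨-i₁ φ ψ) = node (leaf 7) (node (encodeFormula φ) (encodeFormula ψ)) ,
    scheme-↓ (λ (a , b) → a `⇒ a `∨ b) (λ (a , b) → ∨-i₁ a b) (codes₂ φ ψ)
  derivation-code (∨-i₂ φ ψ) = node (leaf 8) (node (encodeFormula φ) (encodeFormula ψ)) ,
    scheme-↓ (λ (a , b) → b `⇒ a `∨ b) (λ (a , b) → ∨-i₂ a b) (codes₂ φ ψ)
  derivation-code (∨-e φ ψ χ) =
    node (leaf 9) (node (encodeFormula φ) (node (encodeFormula ψ) (encodeFormula χ))) ,
    scheme-↓ (λ (a , b , c) → (a `⇒ c) `⇒ (b `⇒ c) `⇒ a `∨ b `⇒ c) (λ (a , b , c) → ∨-e a b c)
             (codes₃ φ ψ χ)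
  derivation-code (efq φ) = node (leaf 10) (encodeFormula φ) ,
    scheme-↓ (`⊥ `⇒_) efq (decodeᶠ-encode φ)
  derivation-code (dne φ) = node (leaf 11) (encodeFormula φ) ,
    scheme-↓ (λ a → `¬ `¬ a `⇒ a) dne (decodeᶠ-encode φ)
  derivation-code (∀-e φ t) = node (leaf 12) (node (encodeFormula φ) (encodeTerm t)) ,
    scheme-↓ (λ (a , u) → `∀ a `⇒ a [ u ]₀) (λ (a , u) → ∀-e a u)
             (cong₂ _,_ (decodeᶠ-encode φ) (decodeᵗ-encode t))
  derivation-code (∃-i φ t) = node (leaf 13) (node (encodeFormula φ) (encodeTerm t)) ,
    scheme-↓ (λ (a , u) → a [ u ]₀ `⇒ `∃ a) (λ (a , u) → ∃-i a u)
             (cong₂ _,_ (decodeᶠ-encode φ) (decodeᵗ-encode t))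
  derivation-code (∀-i {ψ} d) with derivation-code d
  ... | t , hit = node (leaf 14) (node t (encodeFormula ψ)) ,
    subst (λ β → generalise (decodeDerivation t) β ↓ (ψ `⇒ `∀ _)) (sym (decodeᶠ-encode ψ))
          (generalise-↓ hit)
  derivation-code (∃-e {ψ} d) with derivation-code d
  ... | t , hit = node (leaf 15) (node t (encodeFormula ψ)) ,
    subst (λ β → eliminate∃ (decodeDerivation t) β ↓ (`∃ _ `⇒ ψ)) (sym (decodeᶠ-encode ψ))
          (eliminate∃-↓ hit)
  derivation-code (refl= t) = node (leaf 16) (encodeTerm t) ,
    scheme-↓ (λ u → u `= u) refl= (decodeᵗ-encode t)
  derivation-code (subst= φ s t) =
    node (leaf 17) (node (encodeFormula φ) (node (encodeTerm s) (encodeTerm t))) ,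
    scheme-↓ (λ (a , u , v) → u `= v `⇒ a [ u ]₀ `⇒ a [ v ]₀) (λ (a , u , v) → subst= a u v)
             (cong₂ _,_ (decodeᶠ-encode φ) (cong₂ _,_ (decodeᵗ-encode s) (decodeᵗ-encode t)))

  derivations : Decoder (AxiomOf θ ⊢_)
  decode   derivations = decodeDerivation
  complete derivations = derivation-code

-- The decoder for 𝔔′

module _ (Pr : Formula → Formula) where

  Member : Set
  Member = Σ Formula (𝔔′ Pr)

  distributivity : Σ Formula IsΣ₁ → Formula → Formula → Maybe Member
  distributivity (θ , θ-Σ₁) φ ψ =
    dec⇒maybe (freeBelow? 1 θ) >>= λ θ-closed →
    dec⇒maybe (freeBelow? 0 φ) >>= λ φ-sentence →
    dec⇒maybe (freeBelow? 0 ψ) >>= λ ψ-sentence →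
    just (_ , kax θ (θ-Σ₁ , θ-closed) φ ψ φ-sentence ψ-sentence)

  Σ₁-completeness : Σ Formula IsΣ₁ → Σ Formula IsΣ₁ → Tree → Maybe Member
  Σ₁-completeness (σ , σ-Σ₁) (θ , θ-Σ₁) proofs =
    dec⇒maybe (freeBelow? 0 σ) >>= λ σ-sentence →
    dec⇒maybe (freeBelow? 1 θ) >>= λ θ-closed →
    Maybe.map (λ Q⊆U → _ , sax σ σ-Σ₁ σ-sentence θ (θ-Σ₁ , θ-closed) (λ _ → lookupAll Q⊆U))
              (decodeAll (Derivations.derivations θ-Σ₁) _≟ᶠ_ QAxioms proofs)

  distributivity-↓ : ∀ θ′ {θ φ′ φ ψ′ ψ} → proj₁ θ′ ≡ θ → φ′ ≡ φ → ψ′ ≡ ψ →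
                     FreeBelow 1 θ → Sentence φ → Sentence ψ →
                     distributivity θ′ φ′ ψ′ ↓ (PrOf Pr θ (φ `⇒ ψ) `⇒ (PrOf Pr θ φ `⇒ PrOf Pr θ ψ))
  distributivity-↓ (θ , θ-Σ₁) {φ = φ} {ψ = ψ} refl refl refl θ-closed φ-sentence ψ-sentence
    with freeBelow? 1 θ | freeBelow? 0 φ | freeBelow? 0 ψ
  ... | yes _ | yes _ | yes _ = returns _
  ... | no θ-open | _ | _ = ⊥-elim (θ-open θ-closed)
  ... | _ | no φ-open | _ = ⊥-elim (φ-open φ-sentence)
  ... | _ | _ | no ψ-open = ⊥-elim (ψ-open ψ-sentence)

  Σ₁-completeness-returns : ∀ {σ θ} proofs (σ-Σ₁ : IsΣ₁ σ) (θ-Σ₁ : IsΣ₁ θ) →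
    Sentence σ → FreeBelow 1 θ →
    Succeeds (decodeAll (Derivations.derivations θ-Σ₁) _≟ᶠ_ QAxioms proofs) →
    Σ₁-completeness (σ , σ-Σ₁) (θ , θ-Σ₁) proofs ↓ (σ `⇒ PrOf Pr θ σ)
  Σ₁-completeness-returns {σ} {θ} _ σ-Σ₁ θ-Σ₁ σ-sentence θ-closed (_ , decoded)
    with freeBelow? 0 σ | freeBelow? 1 θ
  ... | yes _     | yes _     rewrite decoded = returns _
  ... | no σ-open | _         = ⊥-elim (σ-open σ-sentence)
  ... | _         | no θ-open = ⊥-elim (θ-open θ-closed)

  Σ₁-completeness-↓ : ∀ σ′ θ′ {σ θ} → proj₁ σ′ ≡ σ → proj₁ θ′ ≡ θ →
                      Sentence σ → FreeBelow 1 θ → ExtendsQ θ →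
                      ∃ λ proofs → Σ₁-completeness σ′ θ′ proofs ↓ (σ `⇒ PrOf Pr θ σ)
  Σ₁-completeness-↓ (σ , σ-Σ₁) (θ , θ-Σ₁) refl refl σ-sentence θ-closed Q⊆U
    with decodeAll-complete (Derivations.derivations θ-Σ₁) _≟ᶠ_ (tabulate (Q⊆U _))
  ... | proofs , decoded =
    proofs , Σ₁-completeness-returns proofs σ-Σ₁ θ-Σ₁ σ-sentence θ-closed decoded

  decode𝔔′ : Tree → Maybe Member
  decode𝔔′ (node (leaf 0) (leaf i)) =
    mapCertificate qax (nth QAxioms i)
  decode𝔔′ (node (leaf 1) (node θ (node φ ψ))) =
    distributivity (decodeΣ₁ θ) (decodeFormula φ) (decodeFormula ψ)
  decode𝔔′ (node (leaf 2) (node σ (node θ proofs))) =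
    Σ₁-completeness (decodeΣ₁ σ) (decodeΣ₁ θ) proofs
  decode𝔔′ _ = nothing

  𝔔′-code : ∀ {α} → 𝔔′ Pr α → ∃ λ t → decode𝔔′ t ↓ α
  𝔔′-code (qax α∈Q) with nth-position QAxioms α∈Q
  ... | i , hit = node (leaf 0) (leaf i) , mapCertificate-↓ qax hit
  𝔔′-code (kax θ (θ-Σ₁ , θ-closed) φ ψ φ-sentence ψ-sentence) =
    node (leaf 1) (node (encodeΣ₁ θ-Σ₁) (node (encodeFormula φ) (encodeFormula ψ))) ,
    distributivity-↓ (decodeΣ₁ (encodeΣ₁ θ-Σ₁)) (decodeΣ₁-encode θ-Σ₁)
      (decodeᶠ-encode φ) (decodeᶠ-encode ψ) θ-closed φ-sentence ψ-sentence
  𝔔′-code (sax σ σ-Σ₁ σ-sentence θ (θ-Σ₁ , θ-closed) Q⊆U)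
    with Σ₁-completeness-↓ (decodeΣ₁ (encodeΣ₁ σ-Σ₁)) (decodeΣ₁ (encodeΣ₁ θ-Σ₁))
           (decodeΣ₁-encode σ-Σ₁) (decodeΣ₁-encode θ-Σ₁) σ-sentence θ-closed Q⊆U
  ... | proofs , hit = node (leaf 2) (node (encodeΣ₁ σ-Σ₁) (node (encodeΣ₁ θ-Σ₁) proofs)) , hit

  𝔔′-decoder : Decoder (𝔔′ Pr)
  decode   𝔔′-decoder = decode𝔔′
  complete 𝔔′-decoder = 𝔔′-code

mainTheorem2 : (Pr : Formula → Formula) → RE (GödelSet (𝔔′ Pr))
mainTheorem2 Pr = decodable⇒RE gn (𝔔′-decoder Pr)
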